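{- Every signed graph of maximum average degree less than $3$ admits an edge-sign preserving homomorphism to ${\rm DSG}(K_8,M)$. Moreover, the bound $3$ is best possible, in the sense that there are signed graphs of maximum average degree $3$ admitting no such homomorphism.
   Context: A signed graph $(G,\sigma)$ is a finite simple graph with a signature $\sigma:E(G)\to\{+,-\}$. An edge-sign preserving homomorphism of $(G,\sigma)$ to $(H,\pi)$ is a map $\phi:V(G)\to V(H)$ such that each edge $uv$ is mapped to an edge $\phi(u)\phi(v)$ with $\pi(\phi(u)\phi(v))=\sigma(uv)$. $(K_8,M)$ is the complete graph on vertices $1,\dots,8$ where the edges $12,34,56,78$ are negative and all others positive. ${\rm DSG}(K_8,M)$ has vertex set $\{i^+,i^-:1\le i\le 8\}$; for $i\ne j$ and $\alpha\in\{+,-\}$, $i^\alpha j^\alpha$ is an edge with the same sign as $ij$ in $(K_8,M)$, $i^\alpha j^{ -\alpha}$ is an edge with the opposite sign, and $i^+,i^-$ are non-adjacent. The maximum average degree ${\rm mad}(G)$ is the maximum of $2|E(H)|/|V(H)|$ over nonempty subgraphs $H$ of $G$. -}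

module Defs where

open import Data.Nat using (ℕ; _*_; _<_; _≤_; _/_)
open import Data.Nat as ℕ using ()
open import Data.Bool using (Bool; true; false; T)
open import Data.Fin using (Fin; toℕ)
open import Data.Fin.Properties using () renaming (_≟_ to _≟ᶠ_)
open import Data.Maybe using (Maybe; just; nothing; is-just)
open import Data.List using (List; length; filter; allFin; concatMap; map)
open import Data.Product using (Σ; _×_; _,_; proj₁; proj₂; ∃-syntax)
open import Relation.Binary.PropositionalEquality using (_≡_)
open import Relation.Nullary using (yes; no; ¬_)
open import Relation.Nullary.Decidable using (⌊_⌋)
open import Data.Bool using (T?)

data Sign : Set where
  pos neg : Sign

_·_ : Sign → Sign → Sign
pos · s = s
neg · pos = neg
neg · neg = pos

-- A (finite, simple) signed graph on vertex set Fin n: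
-- σ u v = nothing means u,v non-adjacent, σ u v = just s means uv is an edge of sign s.
record SignedGraph : Set where
  field
    n     : ℕ
    σ     : Fin n → Fin n → Maybe Sign
    sym   : ∀ u v → σ u v ≡ σ v u
    loopless : ∀ u → σ u u ≡ nothing
open SignedGraph public

Hom : (G : SignedGraph) {V : Set} (τ : V → V → Maybe Sign) → Set
Hom G {V} τ = Σ (Fin (n G) → V) λ φ →
  ∀ u v s → σ G u v ≡ just s → τ (φ u) (φ v) ≡ just s

-- (K_8, M) on vertices 0..7 (paper's 1..8 shifted by one);
-- negative edges 01,23,45,67 (paper's 12,34,56,78), all others positive.
K8M : Fin 8 → Fin 8 → Maybe Sign
K8M i j with i ≟ᶠ j
... | yes _ = nothing
... | no _ with toℕ i / 2 ℕ.≟ toℕ j / 2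
...   | yes _ = just neg
...   | no _ = just pos

DSG : Fin 8 × Sign → Fin 8 × Sign → Maybe Sign
DSG (i , α) (j , β) with K8M i j
... | nothing = nothing
... | just s = just (s · (α · β))

vcount : {m : ℕ} → (Fin m → Bool) → ℕ
vcount {m} S = length (filter (λ u → T? (S u)) (allFin m))

pairs : (m : ℕ) → List (Fin m × Fin m)
pairs m = concatMap (λ u → map (λ v → (u , v))
            (filter (λ v → toℕ u ℕ.<? toℕ v) (allFin m))) (allFin m)

-- F u v = true for u < v means the edge {u,v} is chosen; entries with u ≥ v are ignored.
ecount : {m : ℕ} → (Fin m → Fin m → Bool) → ℕ
ecount {m} F = length (filter (λ p → T? (F (proj₁ p) (proj₂ p))) (pairs m))

IsSubgraph : (G : SignedGraph) → (Fin (n G) → Bool) → (Fin (n G) → Fin (n G) → Bool) → Set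
IsSubgraph G S F = ∀ u v → toℕ u < toℕ v → F u v ≡ true →
  T (is-just (σ G u v)) × S u ≡ true × S v ≡ true

MadLt3 : SignedGraph → Set
MadLt3 G = ∀ S F → IsSubgraph G S F → 1 ≤ vcount S → 2 * ecount F < 3 * vcount S

MadEq3 : SignedGraph → Set
MadEq3 G =
  (∀ S F → IsSubgraph G S F → 1 ≤ vcount S → 2 * ecount F ≤ 3 * vcount S) ×
  (∃[ S ] ∃[ F ] (IsSubgraph G S F × 1 ≤ vcount S × 2 * ecount F ≡ 3 * vcount S))

{-# OPTIONS --safe #-}
module Submission where

-- Group the sixteen colours i^α into eight blocks {i^α , i'^α}, where ii' is a negative edge of
-- (K_8, M). A path v w z of length two with z coloured forbids exactly one block for v, while the
-- colours allowed at v by 0, 1 or 2 coloured neighbours meet 8, at least 4, or (if there are any)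
-- at least 2 blocks. So some of the 2-vertices next to v may be deleted, v recoloured, and the
-- 2-vertices put back, as soon as they are fewer than the blocks left to v. If no vertex allows
-- this, let every vertex give 1/2 to each neighbour of degree two: every vertex ends up with at
-- least 3, so the average degree is at least 3.
--
-- For sharpness, join the three vertices of a negative triangle pairwise by negative paths of
-- length two as well: an edge doubled in this way forces the exponents of its two ends to differ,
-- and only two exponents are available.

open import Defs
open import Data.Bool as Bool using (Bool; true; false; T; T?; not; _∧_; if_then_else_)
open import Data.Bool.Properties using (T-≡)
open import Data.Fin as Fin using (Fin; toℕ)
open import Data.Fin.Patterns using (0F; 1F; 2F; 3F; 4F; 5F)
import Data.Fin.Properties as Fin
open import Data.List
  using (List; []; _∷_; _++_; length; map; filter; deduplicate; allFin; concatMap; cartesianProduct)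
open import Data.List.Membership.Propositional using (_∈_; _∉_; find)
open import Data.List.Membership.Propositional.Properties
  using (∈-∃++; ∈-++⁻; ∈-++⁺ˡ; ∈-++⁺ʳ; ∈-deduplicate⁻; ∈-deduplicate⁺; ∈-map⁺; ∈-map⁻;
         ∈-filter⁻; ∈-filter⁺; ∈-allFin; ∈-cartesianProduct⁺)
open import Data.List.Properties using (length-++; length-map; length-filter)
open import Data.List.Relation.Binary.Subset.Propositional using (_⊆_)
open import Data.List.Relation.Unary.All as All using (All; []; _∷_)
import Data.List.Relation.Unary.All.Properties as All
open import Data.List.Relation.Unary.AllPairs using ([]; _∷_)
open import Data.List.Relation.Unary.Any as Any using (here; there)
open import Data.List.Relation.Unary.Unique.Propositional using (Unique)
open import Data.List.Relation.Unary.Unique.DecPropositional.Properties using (deduplicate-!)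
import Data.List.Relation.Unary.Unique.Propositional.Properties as Unique
open import Data.Maybe using (Maybe; just; nothing; is-just; fromMaybe)
import Data.Maybe.Properties as Maybe
open import Data.Nat
open import Data.Nat.ListAction using (sum)
open import Data.Nat.Properties
open import Data.Nat.Tactic.RingSolver using (solve-∀)
open import Data.Product using (_×_; _,_; proj₁; proj₂; ∃-syntax)
import Data.Product.Properties as Prod
open import Data.Sum using (_⊎_; inj₁; inj₂; [_,_]′)
open import Data.Unit using (tt)
open import Data.Vec as Vec using ([]; _∷_)
open import Function using (_∘_)
open import Function.Bundles using (Equivalence)
open import Relation.Binary.Definitions using (DecidableEquality; tri<; tri≈; tri>)
open import Relation.Binary.PropositionalEquality
  using (_≡_; _≢_; refl; cong; cong₂; subst; subst₂; trans; module ≡-Reasoning)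
  renaming (sym to ≡-sym)
open import Relation.Nullary using (Dec; yes; no; ¬_; ¬?; does; contradiction)
open import Relation.Nullary.Decidable
  using (map′; toWitness; dec-true; dec-false; decidable-stable; _×-dec_; _→-dec_; _⊎-dec_)
open import Relation.Unary using (Decidable)

-- Pigeonhole for lists without repetitions.

Unique-⊆⇒length≤ : {A : Set} {xs ys : List A} → Unique xs → xs ⊆ ys → length xs ≤ length ys
Unique-⊆⇒length≤ [] _ = z≤n
Unique-⊆⇒length≤ {xs = x ∷ xs} (x∉xs ∷ xs!) xs⊆ys with ∈-∃++ (xs⊆ys (here refl))
... | as , bs , refl = begin
  suc (length xs)               ≤⟨ s≤s (Unique-⊆⇒length≤ xs! xs⊆as++bs) ⟩
  suc (length (as ++ bs))       ≡⟨ cong suc (length-++ as) ⟩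
  suc (length as + length bs)   ≡⟨ +-suc (length as) (length bs) ⟨
  length as + suc (length bs)   ≡⟨ length-++ as ⟨
  length (as ++ x ∷ bs)         ∎
  where
  open ≤-Reasoning
  xs⊆as++bs : xs ⊆ as ++ bs
  xs⊆as++bs z∈xs with ∈-++⁻ as (xs⊆ys (there z∈xs))
  ... | inj₁ z∈as = ∈-++⁺ˡ z∈as
  ... | inj₂ (here refl) = contradiction refl (All.lookup x∉xs z∈xs)
  ... | inj₂ (there z∈bs) = ∈-++⁺ʳ as z∈bs

module _ {A : Set} (_≟ᴬ_ : DecidableEquality A) where
  open import Data.List.Membership.DecPropositional _≟ᴬ_ using (_∈?_)

  longer-Unique⇒∃∉ : {xs ys : List A} → Unique xs → length ys < length xs →
    ∃[ x ] (x ∈ xs × x ∉ ys)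
  longer-Unique⇒∃∉ {xs} {ys} xs! ys<xs with Any.any? (λ x → ¬? (x ∈? ys)) xs
  ... | yes p = find p
  ... | no ¬p = contradiction ys<xs (≤⇒≯ (Unique-⊆⇒length≤ xs! λ {x} x∈xs →
    decidable-stable (x ∈? ys) (λ x∉ys → ¬p (Any.map (λ { refl → x∉ys }) x∈xs))))

-- Colours, blocks, and finite checks in DSG(K_8, M).

Colour : Set
Colour = Fin 8 × Sign

_≟ˢ_ : DecidableEquality Sign
pos ≟ˢ pos = yes refl
pos ≟ˢ neg = no λ ()
neg ≟ˢ pos = no λ ()
neg ≟ˢ neg = yes refl

allSign? : {P : Sign → Set} → Decidable P → Dec (∀ s → P s)
allSign? P? = map′ (λ { (p , q) pos → p ; (p , q) neg → q }) (λ f → f pos , f neg)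
  (P? pos ×-dec P? neg)

signs : List Sign
signs = pos ∷ neg ∷ []

∈-signs : ∀ s → s ∈ signs
∈-signs pos = here refl
∈-signs neg = there (here refl)

colours : List Colour
colours = cartesianProduct (allFin 8) signs

∈-colours : ∀ c → c ∈ colours
∈-colours (i , α) = ∈-cartesianProduct⁺ (∈-allFin i) (∈-signs α)

allColour? : {P : Colour → Set} → Decidable P → Dec (∀ c → P c)
allColour? P? = map′ (λ ps c → All.lookup ps (∈-colours c)) (λ f → All.tabulate (λ {c} _ → f c))
  (All.all? P? colours)

anyColour? : {P : Colour → Set} → Decidable P → Dec (∃[ c ] P c)
anyColour? P? = map′ (λ p → Any.satisfied p) (λ { (c , p) → Any.map (λ { refl → p }) (∈-colours c) })
  (Any.any? P? colours)

_≟ᵐ_ : DecidableEquality (Maybe Sign)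
_≟ᵐ_ = Maybe.≡-dec _≟ˢ_

abstract
  DSG-sym : ∀ x y → DSG x y ≡ DSG y x
  DSG-sym = toWitness {a? = allColour? λ x → allColour? λ y → DSG x y ≟ᵐ DSG y x} tt

Block : Set
Block = ℕ × Sign

_≟ᵇ_ : DecidableEquality Block
_≟ᵇ_ = Prod.≡-dec _≟_ _≟ˢ_

-- Halving the index identifies the two ends `2k`, `2k+1` of a negative edge of (K_8, M).
block : Colour → Block
block (i , α) = toℕ i / 2 , α

-- The colours at the end of a two-path with signs s and t from y are all but those of this block.
forbidden : Sign → Sign → Colour → Block
forbidden s t (j , β) = toℕ j / 2 , neg · (s · (t · β))

abstract
  -- Let the ends be i^α, j^β and the midpoint k^γ. The exponent γ can correct both signs at once,
  -- so only the product of the signs of ki and kj matters; it has to be s t α β. If i and j lie in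
  -- different pairs, both products occur: positive for k in a third pair, negative for k the
  -- partner of i. If they lie in the same pair, only the positive one occurs, which excludes one
  -- value of α.
  midpoint : ∀ s t x y → block x ≢ forbidden s t y →
    ∃[ c ] (DSG c x ≡ just s × DSG c y ≡ just t)
  midpoint = toWitness {a? = allSign? λ s → allSign? λ t → allColour? λ x → allColour? λ y →
    ¬? (block x ≟ᵇ forbidden s t y) →-dec
    anyColour? λ c → (DSG c x ≟ᵐ just s) ×-dec (DSG c y ≟ᵐ just t)} tt

-- Take `midpoint` with both ends at `x` and equal signs: the forbidden block has the exponent
-- opposite to that of `x`.
colour-neighbour : ∀ s x → ∃[ c ] DSG c x ≡ just s
colour-neighbour s x@(i , α) with midpoint s s x x (s≢ s α ∘ cong proj₂)
  where
  s≢ : ∀ s α → α ≢ neg · (s · (s · α))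
  s≢ pos pos ()
  s≢ pos neg ()
  s≢ neg pos ()
  s≢ neg neg ()
... | c , cx , _ = c , cx

Constraint : Set
Constraint = Colour × Sign

Compatible : List Constraint → Colour → Set
Compatible R c = All (λ (x , s) → DSG c x ≡ just s) R

compatible? : ∀ R → Decidable (Compatible R)
compatible? R c = All.all? (λ (x , s) → DSG c x ≟ᵐ just s) R

blocks : List Constraint → List Block
blocks R = deduplicate _≟ᵇ_ (map block (filter (compatible? R) colours))

-- The number of blocks met by the colours compatible with m constraints, if there are any (0 is
-- a dummy bound for m > 2).
capacity : ℕ → ℕ
capacity 0 = 8
capacity 1 = 4
capacity 2 = 2
capacity _ = 0

abstract
  -- Each of the seven vertices of K_8 other than that of `x` carries one admissible exponent. It is
  -- constant on each of the three pairs avoiding `x`, giving three blocks; the partner of `x` gives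
  -- the fourth.
  capacity-spec₁ : ∀ x s → 4 ≤ length (blocks ((x , s) ∷ []))
  capacity-spec₁ = toWitness {a? = allColour? λ x → allSign? λ s →
    4 ≤? length (blocks ((x , s) ∷ []))} tt

abstract
  -- As for `midpoint`: for ends in different pairs, a positive product leaves the two remaining
  -- pairs and a negative one the two partners, so two blocks. For ends in the same pair there are
  -- at least three blocks or none.
  capacity-spec₂ : ∀ x s y t → length (blocks ((x , s) ∷ (y , t) ∷ [])) ≡ 0
    ⊎ 2 ≤ length (blocks ((x , s) ∷ (y , t) ∷ []))
  capacity-spec₂ = toWitness {a? = allColour? λ x → allSign? λ s → allColour? λ y → allSign? λ t →
    (length (blocks ((x , s) ∷ (y , t) ∷ [])) ≟ 0) ⊎-dec
    (2 ≤? length (blocks ((x , s) ∷ (y , t) ∷ [])))} tt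

∈-blocks⁻ : ∀ R {b} → b ∈ blocks R → ∃[ c ] (Compatible R c × block c ≡ b)
∈-blocks⁻ R b∈ with ∈-map⁻ block (∈-deduplicate⁻ _≟ᵇ_ _ b∈)
... | c , c∈ , refl = c , proj₂ (∈-filter⁻ (compatible? R) {xs = colours} c∈) , refl

∈-blocks⁺ : ∀ R c → Compatible R c → block c ∈ blocks R
∈-blocks⁺ R c ok = ∈-deduplicate⁺ _≟ᵇ_
  (∈-map⁺ block {x = c} (∈-filter⁺ (compatible? R) {x = c} {xs = colours} (∈-colours c) ok))

blocks-nonempty : ∀ R c → Compatible R c → length (blocks R) ≢ 0
blocks-nonempty R c ok with blocks R | ∈-blocks⁺ R c ok
... | _ ∷ _ | _ = λ ()

-- The colour `c` excludes the empty alternative for two constraints; in the application it is the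
-- old colour of the vertex.
capacity≤blocks : ∀ R c → Compatible R c → capacity (length R) ≤ length (blocks R)
capacity≤blocks [] _ _ = ≤-refl
capacity≤blocks ((x , s) ∷ []) _ _ = capacity-spec₁ x s
capacity≤blocks R@((x , s) ∷ (y , t) ∷ []) c ok with capacity-spec₂ x s y t
... | inj₁ empty = contradiction empty (blocks-nonempty R c ok)
... | inj₂ 2≤ = 2≤
capacity≤blocks (_ ∷ _ ∷ _ ∷ _) _ _ = z≤n

abstract
  avoid : ∀ R (F : List Block) c → Compatible R c → length F < capacity (length R) →
    ∃[ c′ ] (Compatible R c′ × block c′ ∉ F)
  avoid R F c ok F< with longer-Unique⇒∃∉ _≟ᵇ_ (deduplicate-! _≟ᵇ_ (map block (filter (compatible? R) colours)))
    (<-≤-trans F< (capacity≤blocks R c ok))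
  ... | b , b∈ , b∉F with ∈-blocks⁻ R b∈
  ...   | c′ , ok′ , refl = c′ , ok′ , b∉F

-- Allows the number of coloured neighbours to be replaced by an upper bound.
capacity-antitone : ∀ {m n} → m ≤ n → capacity n ≤ capacity m
capacity-antitone {n = 0} z≤n = ≤-refl
capacity-antitone {n = 1} z≤n = s≤s (s≤s (s≤s (s≤s z≤n)))
capacity-antitone {n = 2} z≤n = s≤s (s≤s z≤n)
capacity-antitone {n = suc (suc (suc n))} z≤n = z≤n
capacity-antitone {n = 1} (s≤s z≤n) = ≤-refl
capacity-antitone {n = 2} (s≤s z≤n) = s≤s (s≤s z≤n)
capacity-antitone {n = suc (suc (suc n))} _ = z≤n
capacity-antitone {n = 2} (s≤s (s≤s z≤n)) = ≤-refl

-- Extending colourings of vertex subsets.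

module Reduction (G : SignedGraph) where
  V : Set
  V = Fin (n G)

  open import Data.List.Membership.DecPropositional (Fin._≟_ {n G}) using (_∈?_)

  -- Colourings are total maps whose values outside `S` are arbitrary, so deleting vertices leaves
  -- the map as it is.
  Good : (V → Bool) → (V → Colour) → Set
  Good S φ = ∀ u v s → S u ≡ true → S v ≡ true → σ G u v ≡ just s → DSG (φ u) (φ v) ≡ just s

  Fits : (V → Bool) → (V → Colour) → V → Colour → Set
  Fits S φ v c = ∀ u s → S u ≡ true → σ G v u ≡ just s → DSG c (φ u) ≡ just s

  _∖_ : (V → Bool) → List V → V → Bool
  (S ∖ Ws) u = S u ∧ not (does (u ∈? Ws))

  ∖⁺ : ∀ S Ws {u} → S u ≡ true → u ∉ Ws → (S ∖ Ws) u ≡ true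
  ∖⁺ S Ws {u} Su u∉ with S u | u ∈? Ws
  ... | true | yes u∈ = contradiction u∈ u∉
  ... | true | no _ = refl

  ∖⁻ : ∀ S Ws {u} → (S ∖ Ws) u ≡ true → S u ≡ true × u ∉ Ws
  ∖⁻ S Ws {u} eq with S u | u ∈? Ws
  ∖⁻ S Ws {u} () | true | yes _
  ... | true | no u∉ = refl , u∉

  -- Since `Ws` is independent, its vertices are coloured without regard to each other. The colour
  -- stands outside the membership hypothesis so that it depends on the vertex alone.
  extend : ∀ S Ws φ → Good (S ∖ Ws) φ →
    (∀ {u v} → u ∈ Ws → v ∈ Ws → σ G u v ≡ nothing) →
    (∀ w → ∃[ c ] (w ∈ Ws → Fits S φ w c)) → ∃[ φ′ ] Good S φ′
  extend S Ws φ good indep fit = φ′ , good′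
    where
    φ′ : V → Colour
    φ′ u = if does (u ∈? Ws) then proj₁ (fit u) else φ u

    good′ : Good S φ′
    good′ u v s Su Sv e with u ∈? Ws | v ∈? Ws
    ... | yes u∈ | yes v∈ = contradiction (trans (≡-sym e) (indep u∈ v∈)) λ ()
    ... | yes u∈ | no v∉ = proj₂ (fit u) u∈ v s Sv e
    ... | no u∉ | yes v∈ = trans (DSG-sym (φ u) (proj₁ (fit v)))
      (proj₂ (fit v) v∈ u s Su (trans (sym G v u) e))
    ... | no u∉ | no v∉ = good u v s (∖⁺ S Ws Su u∉) (∖⁺ S Ws Sv v∉) e

  _[_≔_] : (V → Colour) → V → Colour → V → Colour
  (φ [ v ≔ c ]) u = if does (u Fin.≟ v) then c else φ u

  update-≡ : ∀ φ v c → (φ [ v ≔ c ]) v ≡ c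
  update-≡ φ v c with v Fin.≟ v
  ... | yes _ = refl
  ... | no v≢v = contradiction refl v≢v

  update-≢ : ∀ φ v c {u} → u ≢ v → (φ [ v ≔ c ]) u ≡ φ u
  update-≢ φ v c {u} u≢v with u Fin.≟ v
  ... | yes u≡v = contradiction u≡v u≢v
  ... | no _ = refl

  nonadjacent-self : ∀ {v s} → σ G v v ≢ just s
  nonadjacent-self {v} e = contradiction (trans (≡-sym e) (loopless G v)) λ ()

  recolour : ∀ S φ v c → Good S φ → Fits S φ v c → Good S (φ [ v ≔ c ])
  recolour S φ v c good fit x y s Sx Sy e with x Fin.≟ v | y Fin.≟ v
  ... | yes refl | yes refl = contradiction e nonadjacent-self
  ... | yes refl | no _ = fit y s Sy e
  ... | no _ | yes refl = trans (DSG-sym (φ x) c) (fit x s Sx (trans (sym G v x) e))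
  ... | no _ | no _ = good x y s Sx Sy e

  neighbours : (V → Bool) → V → List V
  neighbours S v = filter (λ u → T? (S u ∧ is-just (σ G v u))) (allFin (n G))

  degree : (V → Bool) → V → ℕ
  degree S v = length (neighbours S v)

  neighbours-unique : ∀ S v → Unique (neighbours S v)
  neighbours-unique S v = Unique.filter⁺ _ (Unique.allFin⁺ (n G))

  ∈-neighbours⁺ : ∀ S v {u s} → S u ≡ true → σ G v u ≡ just s → u ∈ neighbours S v
  ∈-neighbours⁺ S v {u} {s} Su e = ∈-filter⁺ _ (∈-allFin u) holds
    where
    holds : T (S u ∧ is-just (σ G v u))
    holds rewrite Su | e = tt

  ∈-neighbours⁻ : ∀ S v {u} → u ∈ neighbours S v → S u ≡ true × ∃[ s ] σ G v u ≡ just s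
  ∈-neighbours⁻ S v {u} u∈ with proj₂ (∈-filter⁻ (λ u → T? (S u ∧ is-just (σ G v u))) {xs = allFin (n G)} u∈)
  ... | holds with S u | σ G v u
  ...   | true | just s = refl , s , refl

  neighbour-sym : ∀ S {u v} → S v ≡ true → u ∈ neighbours S v → v ∈ neighbours S u
  neighbour-sym S {u} {v} Sv u∈ with ∈-neighbours⁻ S v u∈
  ... | _ , s , e = ∈-neighbours⁺ S u Sv (trans (sym G u v) e)

  pair-other : ∀ {xs : List V} {v} → length xs ≡ 2 → Unique xs → v ∈ xs →
    ∃[ z ] (z ∈ xs × z ≢ v × (∀ {u} → u ∈ xs → u ≡ v ⊎ u ≡ z))
  pair-other {a ∷ b ∷ []} refl ((a≢b ∷ []) ∷ _) (here refl) = b , there (here refl) , a≢b ∘ ≡-sym ,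
    λ { (here refl) → inj₁ refl ; (there (here refl)) → inj₂ refl }
  pair-other {a ∷ b ∷ []} refl ((a≢b ∷ []) ∷ _) (there (here refl)) = a , here refl , a≢b ,
    λ { (here refl) → inj₂ refl ; (there (here refl)) → inj₁ refl }

  DegreeTwo : (V → Bool) → V → V → Set
  DegreeTwo S v w = w ∈ neighbours S v × degree S w ≡ 2

  -- The other neighbour `z` of `w` completes a two-path from `v`, to which `midpoint` applies. As
  -- `z` differs from `v`, the forbidden block is the same for every new colour `c` of `v`.
  fits-off-block : ∀ S φ v w → S v ≡ true → DegreeTwo S v w →
    ∃[ b ] (∀ c → block c ≢ b → ∃[ d ] Fits S (φ [ v ≔ c ]) w d)
  fits-off-block S φ v w Sv (w∈ , deg2)
    with pair-other deg2 (neighbours-unique S w) (neighbour-sym S Sv w∈)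
  ... | z , z∈ , z≢v , only
    with ∈-neighbours⁻ S w (neighbour-sym S Sv w∈) | ∈-neighbours⁻ S w z∈
  ... | _ , s , wv | _ , t , wz = forbidden s t (φ z) , fit
    where
    fit : ∀ c → block c ≢ forbidden s t (φ z) → ∃[ d ] Fits S (φ [ v ≔ c ]) w d
    fit c c≢ with midpoint s t c (φ z) c≢
    ... | d , dc , dz = d , fits
      where
      fits : Fits S (φ [ v ≔ c ]) w d
      fits u r Su e with only (∈-neighbours⁺ S w Su e)
      ... | inj₁ refl = trans (cong (DSG d) (update-≡ φ v c)) (trans dc (trans (≡-sym wv) e))
      ... | inj₂ refl = trans (cong (DSG d) (update-≢ φ v c z≢v)) (trans dz (trans (≡-sym wz) e))

  -- Here `r` bounds the neighbours of `v` left after deleting `Ws`. They leave at least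
  -- `capacity r` blocks for `v`, and each vertex of `Ws` spoils only one.
  reduce : ∀ S v Ws r φ → S v ≡ true → Unique Ws → (∀ {w} → w ∈ Ws → DegreeTwo S v w) →
    (∀ {u w} → u ∈ Ws → w ∈ Ws → σ G u w ≡ nothing) →
    degree S v ≤ r + length Ws → length Ws < capacity r →
    Good (S ∖ Ws) φ → ∃[ φ′ ] Good S φ′
  reduce S v Ws r φ Sv Ws! two indep deg≤ Ws< good =
    extend S Ws (φ [ v ≔ c ]) (recolour (S ∖ Ws) φ v c good (compatible⇒fits c c-ok)) indep fit
    where
    R : List V
    R = neighbours (S ∖ Ws) v

    -- The remaining neighbours and `Ws` are disjoint sets of neighbours of `v`.
    R≤r : length R ≤ r
    R≤r = +-cancelʳ-≤ (length Ws) (length R) r (begin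
      length R + length Ws    ≡⟨ length-++ R ⟨
      length (R ++ Ws)        ≤⟨ Unique-⊆⇒length≤
        (Unique.++⁺ (neighbours-unique (S ∖ Ws) v) Ws! disjoint) ([ fromR , proj₁ ∘ two ]′ ∘ ∈-++⁻ R) ⟩
      degree S v              ≤⟨ deg≤ ⟩
      r + length Ws           ∎)
      where
      open ≤-Reasoning
      disjoint : ∀ {u} → ¬ (u ∈ R × u ∈ Ws)
      disjoint (u∈R , u∈Ws) = proj₂ (∖⁻ S Ws (proj₁ (∈-neighbours⁻ (S ∖ Ws) v u∈R))) u∈Ws
      fromR : ∀ {u} → u ∈ R → u ∈ neighbours S v
      fromR u∈R with ∈-neighbours⁻ (S ∖ Ws) v u∈R
      ... | Su , s , e = ∈-neighbours⁺ S v (proj₁ (∖⁻ S Ws Su)) e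

    -- This is mapped only over neighbours of `v`, where the sign exists; `pos` makes it total.
    constraint : V → Constraint
    constraint u = φ u , fromMaybe pos (σ G v u)

    compatible⇒fits : ∀ c → Compatible (map constraint R) c → Fits (S ∖ Ws) φ v c
    compatible⇒fits c ok u s Su e =
      trans (All.lookup (All.map⁻ ok) (∈-neighbours⁺ (S ∖ Ws) v Su e)) (cong (just ∘ fromMaybe pos) e)

    -- The vertex `v` is not deleted, so its old colour shows that the constraints can be met.
    v-ok : Compatible (map constraint R) (φ v)
    v-ok = All.map⁺ (All.tabulate ok)
      where
      v∉Ws : v ∉ Ws
      v∉Ws v∈ = nonadjacent-self (proj₂ (proj₂ (∈-neighbours⁻ S v (proj₁ (two v∈)))))
      ok : ∀ {u} → u ∈ R → DSG (φ v) (φ u) ≡ just (fromMaybe pos (σ G v u))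
      ok {u} u∈ with ∈-neighbours⁻ (S ∖ Ws) v u∈
      ... | Su , s , e = trans (good v u s (∖⁺ S Ws Sv v∉Ws) Su e) (cong (just ∘ fromMaybe pos) (≡-sym e))

    -- The dummy block for other `w` makes the block a function of the vertex, ready to be mapped
    -- over `Ws`.
    off : ∀ w → ∃[ b ] (DegreeTwo S v w → ∀ c → block c ≢ b → ∃[ d ] Fits S (φ [ v ≔ c ]) w d)
    off w with w ∈? neighbours S v | degree S w ≟ 2
    ... | yes w∈ | yes deg2 with fits-off-block S φ v w Sv (w∈ , deg2)
    ...   | b , h = b , λ _ → h
    off w | no w∉ | _ = (0 , pos) , λ (w∈ , _) → contradiction w∈ w∉
    off w | _ | no deg≢2 = (0 , pos) , λ (_ , deg2) → contradiction deg2 deg≢2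

    F : List Block
    F = map (proj₁ ∘ off) Ws

    F< : length F < capacity (length (map constraint R))
    F< = begin-strict
      length F                                ≡⟨ length-map _ Ws ⟩
      length Ws                               <⟨ Ws< ⟩
      capacity r                              ≤⟨ capacity-antitone R≤r ⟩
      capacity (length R)                     ≡⟨ cong capacity (length-map constraint R) ⟨
      capacity (length (map constraint R))    ∎
      where open ≤-Reasoning

    choice : ∃[ c ] (Compatible (map constraint R) c × block c ∉ F)
    choice = avoid (map constraint R) F (φ v) v-ok F<

    c : Colour
    c = proj₁ choice

    c-ok : Compatible (map constraint R) c
    c-ok = proj₁ (proj₂ choice)

    fit : ∀ w → ∃[ d ] (w ∈ Ws → Fits S (φ [ v ≔ c ]) w d)
    fit w with w ∈? Ws
    ... | no w∉ = (Fin.zero , pos) , λ w∈ → contradiction w∈ w∉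
    ... | yes w∈ with proj₂ (off w) (two w∈) c
      (λ eq → proj₂ (proj₂ choice) (subst (_∈ F) (≡-sym eq) (∈-map⁺ (proj₁ ∘ off) w∈)))
    ...   | d , h = d , λ _ → h

  -- At most one constraint arises, and `colour-neighbour` meets it.
  insert : ∀ S v φ → degree S v ≤ 1 → Good (S ∖ (v ∷ [])) φ → ∃[ φ′ ] Good S φ′
  insert S v φ deg≤1 good = extend S (v ∷ []) φ good
    (λ { (here refl) (here refl) → loopless G v }) fit
    where
    only : ∀ {xs : List V} {x y} → length xs ≤ 1 → x ∈ xs → y ∈ xs → x ≡ y
    only _ (here refl) (here refl) = refl
    only (s≤s ()) (there {xs = _ ∷ _} _) _
    only (s≤s ()) _ (there {xs = _ ∷ _} _)

    fits : ∃[ c ] Fits S φ v c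
    -- Decides whether `v` has a neighbour at all.
    fits with Any.any? (λ _ → yes tt) (neighbours S v)
    ... | no none = (Fin.zero , pos) , λ u s Su e →
      contradiction (Any.map (λ _ → tt) (∈-neighbours⁺ S v Su e)) none
    ... | yes some with find some
    ...   | x , x∈ , _ with ∈-neighbours⁻ S v x∈
    ...     | Sx , s , vx with colour-neighbour s (φ x)
    ...       | c , cx = c , λ u t Su vu →
      fit-at c u t (only deg≤1 x∈ (∈-neighbours⁺ S v Su vu)) cx vx vu
      where
      fit-at : ∀ c u t {x s} → x ≡ u → DSG c (φ x) ≡ just s → σ G v x ≡ just s →
        σ G v u ≡ just t → DSG c (φ u) ≡ just t
      fit-at c u t refl cx vx vu = trans cx (trans (≡-sym vx) vu)

    fit : ∀ w → ∃[ c ] (w ∈ v ∷ [] → Fits S φ w c)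
    fit w with w Fin.≟ v
    ... | yes refl = proj₁ fits , λ _ → proj₂ fits
    ... | no w≢v = (Fin.zero , pos) , λ { (here w≡v) → contradiction w≡v w≢v }

-- Finite sums and double counting.

⟦_⟧ : Bool → ℕ
⟦ true ⟧ = 1
⟦ false ⟧ = 0

⟦∧⟧ : ∀ a b → ⟦ a ∧ b ⟧ ≡ ⟦ a ⟧ * ⟦ b ⟧
⟦∧⟧ true b = ≡-sym (*-identityˡ ⟦ b ⟧)
⟦∧⟧ false b = refl

module _ {A : Set} where

  ∑ : List A → (A → ℕ) → ℕ
  ∑ xs f = sum (map f xs)

  ∑-cong : ∀ xs {f g : A → ℕ} → (∀ x → f x ≡ g x) → ∑ xs f ≡ ∑ xs g
  ∑-cong [] _ = refl
  ∑-cong (x ∷ xs) f≡g = cong₂ _+_ (f≡g x) (∑-cong xs f≡g)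

  ∑-mono-≤ : ∀ xs {f g : A → ℕ} → (∀ x → f x ≤ g x) → ∑ xs f ≤ ∑ xs g
  ∑-mono-≤ [] _ = z≤n
  ∑-mono-≤ (x ∷ xs) f≤g = +-mono-≤ (f≤g x) (∑-mono-≤ xs f≤g)

  ∑-zero : ∀ (xs : List A) → ∑ xs (λ _ → 0) ≡ 0
  ∑-zero [] = refl
  ∑-zero (x ∷ xs) = ∑-zero xs

  ∑-+ : ∀ xs (f g : A → ℕ) → ∑ xs (λ x → f x + g x) ≡ ∑ xs f + ∑ xs g
  ∑-+ [] f g = refl
  ∑-+ (x ∷ xs) f g = begin
    f x + g x + ∑ xs (λ x → f x + g x)  ≡⟨ cong (f x + g x +_) (∑-+ xs f g) ⟩
    f x + g x + (∑ xs f + ∑ xs g)       ≡⟨ interchange (f x) (g x) (∑ xs f) (∑ xs g) ⟩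
    f x + ∑ xs f + (g x + ∑ xs g)       ∎
    where
    open ≡-Reasoning
    interchange : ∀ a b c d → a + b + (c + d) ≡ a + c + (b + d)
    interchange = solve-∀

  ∑-*ˡ : ∀ xs k (f : A → ℕ) → ∑ xs (λ x → k * f x) ≡ k * ∑ xs f
  ∑-*ˡ [] k f = ≡-sym (*-zeroʳ k)
  ∑-*ˡ (x ∷ xs) k f = trans (cong (k * f x +_) (∑-*ˡ xs k f)) (≡-sym (*-distribˡ-+ k (f x) (∑ xs f)))

  ∑<⇒∃< : ∀ xs (f g : A → ℕ) → ∑ xs f < ∑ xs g → ∃[ x ] f x < g x
  ∑<⇒∃< (x ∷ xs) f g lt with f x <? g x
  ... | yes fx<gx = x , fx<gx
  ... | no fx≮gx = ∑<⇒∃< xs f g (≰⇒> λ ≥ → <⇒≱ lt (+-mono-≤ (≮⇒≥ fx≮gx) ≥))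

  length-filter-∑ : ∀ {P : A → Set} (P? : Decidable P) xs →
    length (filter P? xs) ≡ ∑ xs (λ x → ⟦ does (P? x) ⟧)
  length-filter-∑ P? [] = refl
  length-filter-∑ P? (x ∷ xs) with does (P? x)
  ... | true = cong suc (length-filter-∑ P? xs)
  ... | false = length-filter-∑ P? xs

  ∑-filter : ∀ {P : A → Set} (P? : Decidable P) xs (f : A → ℕ) →
    ∑ (filter P? xs) f ≡ ∑ xs (λ x → ⟦ does (P? x) ⟧ * f x)
  ∑-filter P? [] f = refl
  ∑-filter P? (x ∷ xs) f with does (P? x)
  ... | true = cong₂ _+_ (≡-sym (+-identityʳ (f x))) (∑-filter P? xs f)
  ... | false = ∑-filter P? xs f

  ∑-++ : ∀ xs ys (f : A → ℕ) → ∑ (xs ++ ys) f ≡ ∑ xs f + ∑ ys f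
  ∑-++ [] ys f = refl
  ∑-++ (x ∷ xs) ys f = trans (cong (f x +_) (∑-++ xs ys f)) (≡-sym (+-assoc (f x) (∑ xs f) (∑ ys f)))

module _ {A B : Set} where

  ∑-swap : ∀ xs ys (f : A → B → ℕ) →
    ∑ xs (λ x → ∑ ys (f x)) ≡ ∑ ys (λ y → ∑ xs (λ x → f x y))
  ∑-swap [] ys f = ≡-sym (∑-zero ys)
  ∑-swap (x ∷ xs) ys f = trans (cong (∑ ys (f x) +_) (∑-swap xs ys f))
    (≡-sym (∑-+ ys (f x) (λ y → ∑ xs (λ x → f x y))))

  ∑-map : ∀ (h : A → B) xs (f : B → ℕ) → ∑ (map h xs) f ≡ ∑ xs (f ∘ h)
  ∑-map h [] f = refl
  ∑-map h (x ∷ xs) f = cong (f (h x) +_) (∑-map h xs f)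

  ∑-concatMap : ∀ (h : A → List B) xs (f : B → ℕ) →
    ∑ (concatMap h xs) f ≡ ∑ xs (λ x → ∑ (h x) f)
  ∑-concatMap h [] f = refl
  ∑-concatMap h (x ∷ xs) f = trans (∑-++ (h x) (concatMap h xs) f) (cong (∑ (h x) f +_) (∑-concatMap h xs f))

module _ {m : ℕ} where

  below : Fin m → Fin m → ℕ
  below u v = ⟦ does (toℕ u <? toℕ v) ⟧

  vcount-∑ : ∀ (S : Fin m → Bool) → vcount S ≡ ∑ (allFin m) (⟦_⟧ ∘ S)
  vcount-∑ S = length-filter-∑ (T? ∘ S) (allFin m)

  ecount-∑ : ∀ (F : Fin m → Fin m → Bool) →
    ecount F ≡ ∑ (allFin m) (λ u → ∑ (allFin m) (λ v → below u v * ⟦ F u v ⟧))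
  ecount-∑ F = begin
    ecount F
      ≡⟨ length-filter-∑ (λ p → T? (F (proj₁ p) (proj₂ p))) (pairs m) ⟩
    ∑ (pairs m) F′
      ≡⟨ ∑-concatMap _ (allFin m) F′ ⟩
    ∑ (allFin m) (λ u → ∑ (map (u ,_) (filter (λ v → toℕ u <? toℕ v) (allFin m))) F′)
      ≡⟨ ∑-cong (allFin m) (λ u → trans
           (∑-map (u ,_) (filter (λ v → toℕ u <? toℕ v) (allFin m)) F′)
           (∑-filter (λ v → toℕ u <? toℕ v) (allFin m) (λ v → ⟦ F u v ⟧))) ⟩
    ∑ (allFin m) (λ u → ∑ (allFin m) (λ v → below u v * ⟦ F u v ⟧))
      ∎
    where
    open ≡-Reasoning
    F′ : Fin m × Fin m → ℕ
    F′ (u , v) = ⟦ F u v ⟧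

  -- Trichotomy of the indices splits the ordered pairs; the two strict parts agree by symmetry and
  -- the diagonal vanishes.
  handshake : ∀ (g : Fin m → Fin m → ℕ) → (∀ u v → g u v ≡ g v u) → (∀ u → g u u ≡ 0) →
    ∑ (allFin m) (λ u → ∑ (allFin m) (g u)) ≡
    2 * ∑ (allFin m) (λ u → ∑ (allFin m) (λ v → below u v * g u v))
  handshake g g-sym g-irrefl = begin
    ∑ L (λ u → ∑ L (g u))
      ≡⟨ ∑-cong L (λ u → trans (∑-cong L (split u)) (∑-+ L (upper u) (λ v → upper v u))) ⟩
    ∑ L (λ u → ∑ L (upper u) + ∑ L (λ v → upper v u))
      ≡⟨ ∑-+ L _ _ ⟩
    X + ∑ L (λ u → ∑ L (λ v → upper v u))
      ≡⟨ cong (X +_) (∑-swap L L (λ u v → upper v u)) ⟩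
    X + X
      ≡⟨ cong (X +_) (+-identityʳ X) ⟨
    2 * X ∎
    where
    open ≡-Reasoning
    L : List (Fin m)
    L = allFin m
    upper : Fin m → Fin m → ℕ
    upper u v = below u v * g u v
    X : ℕ
    X = ∑ L (λ u → ∑ L (upper u))
    split : ∀ u v → g u v ≡ upper u v + upper v u
    split u v with <-cmp (toℕ u) (toℕ v)
    ... | tri< u<v _ v≮u rewrite dec-true (toℕ u <? toℕ v) u<v | dec-false (toℕ v <? toℕ u) v≮u =
      ≡-sym (trans (+-identityʳ _) (+-identityʳ _))
    ... | tri> u≮v _ v<u rewrite dec-false (toℕ u <? toℕ v) u≮v | dec-true (toℕ v <? toℕ u) v<u =
      trans (g-sym u v) (≡-sym (+-identityʳ _))
    ... | tri≈ _ u≡v _ with Fin.toℕ-injective u≡v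
    ...   | refl rewrite g-irrefl u = ≡-sym (cong₂ _+_ (*-zeroʳ (below u u)) (*-zeroʳ (below u u)))

  -- The comparison is assumed only for `u < v`, the range where `IsSubgraph` restricts the chosen
  -- edges.
  below-*-mono-≤ : ∀ u v {a b} → (toℕ u < toℕ v → a ≤ b) → below u v * a ≤ below u v * b
  below-*-mono-≤ u v a≤b with toℕ u <? toℕ v
  ... | yes u<v = *-monoʳ-≤ (below u v) (a≤b u<v)
  ... | no u≮v rewrite dec-false (toℕ u <? toℕ v) u≮v = z≤n

-- Discharging.

module Discharging (G : SignedGraph) where
  open Reduction G

  induced : (V → Bool) → V → V → Bool
  induced S u v = S u ∧ (S v ∧ is-just (σ G u v))

  induced-subgraph : ∀ S → IsSubgraph G S (induced S)
  induced-subgraph S u v _ eq with S u | S v | is-just (σ G u v)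
  ... | true | true | true = tt , refl , refl

  private
    L : List V
    L = allFin (n G)

  two : (V → Bool) → V → ℕ
  two S v = ⟦ does (degree S v ≟ 2) ⟧

  twoNeighbours : (V → Bool) → V → List V
  twoNeighbours S v = filter (λ w → degree S w ≟ 2) (neighbours S v)

  -- `degree S v` also counts for `v` outside `S`; the factor `⟦ S v ⟧` makes the summand symmetric,
  -- as `handshake` requires.
  degree-∑ : ∀ S v → ⟦ S v ⟧ * degree S v ≡ ∑ L (λ u → ⟦ induced S v u ⟧)
  degree-∑ S v = begin
    ⟦ S v ⟧ * degree S v
      ≡⟨ cong (⟦ S v ⟧ *_) (length-filter-∑ _ L) ⟩
    ⟦ S v ⟧ * ∑ L (λ u → ⟦ S u ∧ is-just (σ G v u) ⟧)
      ≡⟨ ∑-*ˡ L ⟦ S v ⟧ _ ⟨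
    ∑ L (λ u → ⟦ S v ⟧ * ⟦ S u ∧ is-just (σ G v u) ⟧)
      ≡⟨ ∑-cong L (λ u → ⟦∧⟧ (S v) _) ⟨
    ∑ L (λ u → ⟦ induced S v u ⟧) ∎
    where open ≡-Reasoning

  twoNeighbours-∑ : ∀ S v →
    ⟦ S v ⟧ * length (twoNeighbours S v) ≡ ∑ L (λ u → two S u * ⟦ induced S v u ⟧)
  twoNeighbours-∑ S v = begin
    ⟦ S v ⟧ * length (twoNeighbours S v)
      ≡⟨ cong (⟦ S v ⟧ *_) (length-filter-∑ _ (neighbours S v)) ⟩
    ⟦ S v ⟧ * ∑ (neighbours S v) (two S)
      ≡⟨ cong (⟦ S v ⟧ *_) (∑-filter _ L (two S)) ⟩
    ⟦ S v ⟧ * ∑ L (λ u → ⟦ S u ∧ is-just (σ G v u) ⟧ * two S u)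
      ≡⟨ ∑-*ˡ L ⟦ S v ⟧ _ ⟨
    ∑ L (λ u → ⟦ S v ⟧ * (⟦ S u ∧ is-just (σ G v u) ⟧ * two S u))
      ≡⟨ ∑-cong L (λ u → trans (rotate ⟦ S v ⟧ _ (two S u))
           (cong (two S u *_) (≡-sym (⟦∧⟧ (S v) (S u ∧ is-just (σ G v u)))))) ⟩
    ∑ L (λ u → two S u * ⟦ induced S v u ⟧) ∎
    where
    open ≡-Reasoning
    rotate : ∀ a b c → a * (b * c) ≡ c * (a * b)
    rotate = solve-∀

  induced-sym : ∀ S u v → ⟦ induced S u v ⟧ ≡ ⟦ induced S v u ⟧
  induced-sym S u v rewrite sym G u v with S u | S v
  ... | true | true = refl
  ... | true | false = refl
  ... | false | true = refl
  ... | false | false = refl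

  induced-irrefl : ∀ S u → ⟦ induced S u u ⟧ ≡ 0
  induced-irrefl S u rewrite loopless G u with S u
  ... | true = refl
  ... | false = refl

  degree-sum : ∀ S → ∑ L (λ v → ⟦ S v ⟧ * degree S v) ≡ 2 * ecount (induced S)
  degree-sum S = begin
    ∑ L (λ v → ⟦ S v ⟧ * degree S v)
      ≡⟨ ∑-cong L (degree-∑ S) ⟩
    ∑ L (λ v → ∑ L (λ u → ⟦ induced S v u ⟧))
      ≡⟨ handshake (λ u v → ⟦ induced S u v ⟧) (induced-sym S) (induced-irrefl S) ⟩
    2 * ∑ L (λ u → ∑ L (λ v → below u v * ⟦ induced S u v ⟧))
      ≡⟨ cong (2 *_) (ecount-∑ (induced S)) ⟨
    2 * ecount (induced S) ∎
    where open ≡-Reasoning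

  -- Charge given equals charge received: swapping the sums counts each vertex of degree two once
  -- from each of its two neighbours.
  twoNeighbours-sum : ∀ S →
    ∑ L (λ v → ⟦ S v ⟧ * length (twoNeighbours S v)) ≡ ∑ L (λ v → ⟦ S v ⟧ * (2 * two S v))
  twoNeighbours-sum S = begin
    ∑ L (λ v → ⟦ S v ⟧ * length (twoNeighbours S v))
      ≡⟨ ∑-cong L (twoNeighbours-∑ S) ⟩
    ∑ L (λ v → ∑ L (λ u → two S u * ⟦ induced S v u ⟧))
      ≡⟨ ∑-swap L L (λ v u → two S u * ⟦ induced S v u ⟧) ⟩
    ∑ L (λ u → ∑ L (λ v → two S u * ⟦ induced S v u ⟧))
      ≡⟨ ∑-cong L (λ u → trans (∑-*ˡ L (two S u) _) (cong (two S u *_)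
           (trans (∑-cong L (λ v → induced-sym S v u)) (≡-sym (degree-∑ S u))))) ⟩
    ∑ L (λ u → two S u * (⟦ S u ⟧ * degree S u))
      ≡⟨ ∑-cong L (λ u → trans (swap (two S u) ⟦ S u ⟧ (degree S u))
           (cong (⟦ S u ⟧ *_) (weight (degree S u)))) ⟩
    ∑ L (λ v → ⟦ S v ⟧ * (2 * two S v)) ∎
    where
    open ≡-Reasoning
    swap : ∀ a b c → a * (b * c) ≡ b * (c * a)
    swap = solve-∀
    weight : ∀ d → d * ⟦ does (d ≟ 2) ⟧ ≡ 2 * ⟦ does (d ≟ 2) ⟧
    weight 0 = refl
    weight 1 = refl
    weight 2 = refl
    weight d@(suc (suc (suc _))) = *-zeroʳ d

  -- A vertex of degree d with t neighbours of degree two starts with charge d and ends with d -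
  -- t/2, plus 1 if d = 2. The total is unchanged, so some final charge is below 3; the inequality
  -- is doubled and t moved to the right to stay in ℕ.
  light-vertex : ∀ S → 2 * ecount (induced S) < 3 * vcount S →
    ∃[ v ] (S v ≡ true × 2 * degree S v + 2 * two S v < 6 + length (twoNeighbours S v))
  light-vertex S sparse = positive (∑<⇒∃< L
    (λ v → ⟦ S v ⟧ * (2 * degree S v + 2 * two S v))
    (λ v → ⟦ S v ⟧ * (6 + length (twoNeighbours S v))) lt)
    where
    -- Twice the charge that moves; it enters both totals and cancels.
    Y : ℕ
    Y = ∑ L (λ v → ⟦ S v ⟧ * (2 * two S v))
    lhs : ∑ L (λ v → ⟦ S v ⟧ * (2 * degree S v + 2 * two S v)) ≡ 2 * (2 * ecount (induced S)) + Y
    lhs = begin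
      ∑ L (λ v → ⟦ S v ⟧ * (2 * degree S v + 2 * two S v))
        ≡⟨ ∑-cong L (λ v → expand ⟦ S v ⟧ (degree S v) (2 * two S v)) ⟩
      ∑ L (λ v → 2 * (⟦ S v ⟧ * degree S v) + ⟦ S v ⟧ * (2 * two S v))
        ≡⟨ ∑-+ L _ _ ⟩
      ∑ L (λ v → 2 * (⟦ S v ⟧ * degree S v)) + Y
        ≡⟨ cong (_+ Y) (trans (∑-*ˡ L 2 _) (cong (2 *_) (degree-sum S))) ⟩
      2 * (2 * ecount (induced S)) + Y ∎
      where
      open ≡-Reasoning
      expand : ∀ s d t → s * (2 * d + t) ≡ 2 * (s * d) + s * t
      expand = solve-∀
    rhs : ∑ L (λ v → ⟦ S v ⟧ * (6 + length (twoNeighbours S v))) ≡ 2 * (3 * vcount S) + Y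
    rhs = begin
      ∑ L (λ v → ⟦ S v ⟧ * (6 + length (twoNeighbours S v)))
        ≡⟨ ∑-cong L (λ v → expand ⟦ S v ⟧ (length (twoNeighbours S v))) ⟩
      ∑ L (λ v → 6 * ⟦ S v ⟧ + ⟦ S v ⟧ * length (twoNeighbours S v))
        ≡⟨ ∑-+ L _ _ ⟩
      ∑ L (λ v → 6 * ⟦ S v ⟧) + ∑ L (λ v → ⟦ S v ⟧ * length (twoNeighbours S v))
        ≡⟨ cong₂ _+_ (trans (∑-*ˡ L 6 _) (cong (6 *_) (≡-sym (vcount-∑ S)))) (twoNeighbours-sum S) ⟩
      6 * vcount S + Y
        ≡⟨ cong (_+ Y) (*-assoc 2 3 (vcount S)) ⟩
      2 * (3 * vcount S) + Y ∎
      where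
      open ≡-Reasoning
      expand : ∀ s t → s * (6 + t) ≡ 6 * s + s * t
      expand = solve-∀
    lt : ∑ L (λ v → ⟦ S v ⟧ * (2 * degree S v + 2 * two S v)) <
         ∑ L (λ v → ⟦ S v ⟧ * (6 + length (twoNeighbours S v)))
    lt = begin-strict
      ∑ L (λ v → ⟦ S v ⟧ * (2 * degree S v + 2 * two S v))       ≡⟨ lhs ⟩
      2 * (2 * ecount (induced S)) + Y                           <⟨ +-monoˡ-< Y (*-monoʳ-< 2 sparse) ⟩
      2 * (3 * vcount S) + Y                                     ≡⟨ rhs ⟨
      ∑ L (λ v → ⟦ S v ⟧ * (6 + length (twoNeighbours S v)))     ∎
      where open ≤-Reasoning
    positive : ∃[ v ] ⟦ S v ⟧ * (2 * degree S v + 2 * two S v) <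
                      ⟦ S v ⟧ * (6 + length (twoNeighbours S v)) →
      ∃[ v ] (S v ≡ true × 2 * degree S v + 2 * two S v < 6 + length (twoNeighbours S v))
    -- Outside `S` both sides are 0, contradicting strictness.
    positive (v , lt) with S v in Sv
    ... | true = v , Sv , subst₂ _<_ (*-identityˡ _) (*-identityˡ _) lt

-- Induction on the number of vertices.

module Sparse (G : SignedGraph) (mad : MadLt3 G) where
  open Reduction G
  open Discharging G

  -- Prepending the deleted `w` to the remaining vertices keeps the list repetition-free and inside
  -- `S`, whence strictness.
  vcount-∖ : ∀ S Ws {w} → S w ≡ true → w ∈ Ws → vcount (S ∖ Ws) < vcount S
  vcount-∖ S Ws {w} Sw w∈ = Unique-⊆⇒length≤
    (All.tabulate w∉ ∷ Unique.filter⁺ _ (Unique.allFin⁺ (n G)))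
    λ { (here refl) → ∈-filter⁺ _ (∈-allFin w) (Equivalence.from T-≡ Sw)
      ; (there u∈) → ∈-filter⁺ _ (∈-allFin _) (Equivalence.from T-≡ (proj₁ (member u∈))) }
    where
    member : ∀ {u} → u ∈ filter (λ u → T? ((S ∖ Ws) u)) (allFin (n G)) → S u ≡ true × u ∉ Ws
    member u∈ = ∖⁻ S Ws (Equivalence.to T-≡ (proj₂ (∈-filter⁻ (λ u → T? ((S ∖ Ws) u)) {xs = allFin (n G)} u∈)))
    w∉ : ∀ {u} → u ∈ filter (λ u → T? ((S ∖ Ws) u)) (allFin (n G)) → w ≢ u
    w∉ u∈ refl = proj₂ (member u∈) w∈

  ∈-twoNeighbours⁺ : ∀ S v {w} → DegreeTwo S v w → w ∈ twoNeighbours S v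
  ∈-twoNeighbours⁺ S v (w∈ , deg2) = ∈-filter⁺ _ w∈ deg2

  ∈-twoNeighbours⁻ : ∀ S v {w} → w ∈ twoNeighbours S v → DegreeTwo S v w
  ∈-twoNeighbours⁻ S v w∈ = ∈-filter⁻ (λ w → degree S w ≟ 2) w∈

  ∈⇒1≤length : ∀ {A : Set} {x : A} {xs} → x ∈ xs → 1 ≤ length xs
  ∈⇒1≤length (here _) = s≤s z≤n
  ∈⇒1≤length (there _) = s≤s z≤n

  1≤length⇒∃∈ : ∀ {A : Set} {xs : List A} → 1 ≤ length xs → ∃[ x ] x ∈ xs
  1≤length⇒∃∈ {xs = x ∷ _} _ = x , here refl

  twoNeighbours-length : ∀ S v → length (twoNeighbours S v) ≤ degree S v
  twoNeighbours-length S v = length-filter (λ w → degree S w ≟ 2) (neighbours S v)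

  -- Twice the inequality "final charge < 3" for degree d with t neighbours of degree two; it leaves
  -- only d = 4 with t ≥ 3 and d = t = 5.
  Crowded : ℕ → ℕ → Set
  Crowded d t = 2 * d + 2 * ⟦ does (d ≟ 2) ⟧ < 6 + t → t ≤ d → ¬ d ≤ 1 → ¬ (d ≤ 3 × 1 ≤ t) →
    1 ≤ t × t < capacity (d ∸ t)

  crowded? : ∀ d t → Dec (Crowded d t)
  crowded? d t = (2 * d + 2 * ⟦ does (d ≟ 2) ⟧ <? 6 + t) →-dec ((t ≤? d) →-dec (¬? (d ≤? 1) →-dec
    (¬? ((d ≤? 3) ×-dec (1 ≤? t)) →-dec ((1 ≤? t) ×-dec (t <? capacity (d ∸ t))))))

  -- With t ≤ d the first inequality forces d < 6, leaving a finite check. In the surviving cases d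
  -- - t is 1 with t = 3, or 0 with t = 4 or 5, and the capacities 4 and 8 suffice.
  crowded : ∀ d t → Crowded d t
  crowded d t light t≤d = toWitness {a? = allUpTo? (λ d → allUpTo? (crowded? d) 6) 6} tt
    d<6 (≤-<-trans t≤d d<6) light t≤d
    where
    open ≤-Reasoning
    d<6 : d < 6
    d<6 = +-cancelʳ-< d d 6 (begin-strict
      d + d                                  ≡⟨ cong (d +_) (+-identityʳ d) ⟨
      2 * d                                  ≤⟨ m≤m+n (2 * d) _ ⟩
      2 * d + 2 * ⟦ does (d ≟ 2) ⟧           <⟨ light ⟩
      6 + t                                  ≤⟨ +-monoʳ-≤ 6 t≤d ⟩
      6 + d                                  ∎)

  Low : (V → Bool) → Set
  Low S = ∃[ v ] (S v ≡ true × degree S v ≤ 1)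

  NearTwo : (V → Bool) → Set
  NearTwo S = ∃[ v ] (S v ≡ true × degree S v ≤ 3 × 1 ≤ length (twoNeighbours S v))

  low? : ∀ S → Dec (Low S)
  low? S = Fin.any? λ v → (S v Bool.≟ true) ×-dec (degree S v ≤? 1)

  nearTwo? : ∀ S → Dec (NearTwo S)
  nearTwo? S = Fin.any? λ v → (S v Bool.≟ true) ×-dec
    ((degree S v ≤? 3) ×-dec (1 ≤? length (twoNeighbours S v)))

  Colourable : (V → Bool) → Set
  Colourable S = ∃[ φ ] Good S φ

  module Step (S : V → Bool) (smaller : ∀ T → vcount T < vcount S → Colourable T) where

    delete-low : Low S → Colourable S
    delete-low (v , Sv , deg≤1) =
      let φ , good = smaller (S ∖ (v ∷ [])) (vcount-∖ S (v ∷ []) Sv (here refl))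
      in insert S v φ deg≤1 good

    delete-two : ∀ v Ws r → S v ≡ true → Unique Ws → (∀ {w} → w ∈ Ws → DegreeTwo S v w) →
      (∀ {u w} → u ∈ Ws → w ∈ Ws → σ G u w ≡ nothing) →
      degree S v ≤ r + length Ws → length Ws < capacity r → 1 ≤ length Ws → Colourable S
    delete-two v Ws r Sv Ws! two indep deg≤ Ws< 1≤Ws =
      let w , w∈ = 1≤length⇒∃∈ 1≤Ws
          φ , good = smaller (S ∖ Ws) (vcount-∖ S Ws (proj₁ (∈-neighbours⁻ S v (proj₁ (two w∈)))) w∈)
      in reduce S v Ws r φ Sv Ws! two indep deg≤ Ws< good

    -- Deleting one vertex of degree two leaves `v` at most two neighbours, hence two blocks, of
    -- which one is forbidden.
    delete-nearTwo : NearTwo S → Colourable S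
    delete-nearTwo (v , Sv , deg≤3 , some) =
      let w , w∈ = 1≤length⇒∃∈ some
      in delete-two v (w ∷ []) 2 Sv ([] ∷ []) (λ { (here refl) → ∈-twoNeighbours⁻ S v w∈ })
           (λ { (here refl) (here refl) → loopless G w }) deg≤3 ≤-refl ≤-refl

    -- If `u` and `w` were adjacent, `u` itself would witness `NearTwo S`.
    independent : ¬ NearTwo S → ∀ {v u w} → DegreeTwo S v u → DegreeTwo S v w → σ G u w ≡ nothing
    independent noTwo {v} {u} {w} (u∈ , deg-u) (w∈ , deg-w) with σ G u w in uw
    ... | nothing = refl
    ... | just s = contradiction
      (u , proj₁ (∈-neighbours⁻ S v u∈) , subst (_≤ 3) (≡-sym deg-u) (s≤s (s≤s z≤n)) ,
        ∈⇒1≤length (∈-twoNeighbours⁺ S u (∈-neighbours⁺ S u (proj₁ (∈-neighbours⁻ S v w∈)) uw , deg-w)))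
      noTwo

    -- The sparsity hypothesis enters here, for the subgraph induced by `S`. All neighbours of
    -- degree two of the light vertex are deleted at once.
    delete-crowd : ¬ Low S → ¬ NearTwo S → 1 ≤ vcount S → Colourable S
    delete-crowd noLow noTwo 1≤S =
      let v , Sv , light = light-vertex S (mad S (induced S) (induced-subgraph S) 1≤S)
          t≤d = twoNeighbours-length S v
          1≤t , t< = crowded (degree S v) (length (twoNeighbours S v)) light t≤d
            (λ deg≤1 → noLow (v , Sv , deg≤1)) (λ few → noTwo (v , Sv , few))
      in delete-two v (twoNeighbours S v) (degree S v ∸ length (twoNeighbours S v)) Sv
           (Unique.filter⁺ _ (neighbours-unique S v)) (∈-twoNeighbours⁻ S v)
           (λ u∈ w∈ → independent noTwo (∈-twoNeighbours⁻ S v u∈) (∈-twoNeighbours⁻ S v w∈))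
           (≤-reflexive (≡-sym (m∸n+n≡m t≤d))) t< 1≤t

    step : 1 ≤ vcount S → Dec (Low S) → Dec (NearTwo S) → Colourable S
    step _ (yes low) _ = delete-low low
    step _ (no _) (yes near) = delete-nearTwo near
    step 1≤S (no noLow) (no noTwo) = delete-crowd noLow noTwo 1≤S

  colour-empty : ∀ S → vcount S ≤ 0 → Colourable S
  colour-empty S S≤0 = (λ _ → Fin.zero , pos) , λ u v s Su → contradiction
    (≤-trans (∈⇒1≤length {xs = filter (λ u → T? (S u)) (allFin (n G))}
      (∈-filter⁺ (λ u → T? (S u)) (∈-allFin u) (Equivalence.from T-≡ Su))) S≤0) λ ()

  -- Strong induction on `vcount S`, with `k` as a running bound.
  colour : ∀ k S → vcount S ≤ k → Colourable S
  colour zero S S≤0 = colour-empty S S≤0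
  colour (suc k) S S≤ with 1 ≤? vcount S
  ... | no S<1 = colour-empty S (≤-pred (≰⇒> S<1))
  ... | yes 1≤S = Step.step S (λ T T< → colour k T (≤-pred (<-≤-trans T< S≤))) 1≤S (low? S) (nearTwo? S)

  hom : Hom G DSG
  hom = let φ , good = colour (vcount {n G} (λ _ → true)) (λ _ → true) ≤-refl
        in φ , λ u v s → good u v s refl refl

-- The sharpness example.

allBool? : {P : Bool → Set} → (∀ b → Dec (P b)) → Dec (∀ b → P b)
allBool? P? = map′ (λ { (p , q) true → p ; (p , q) false → q }) (λ f → f true , f false)
  (P? true ×-dec P? false)

-- Vertices 3, 4, 5 are the midpoints of the negative paths joining 01, 02, 12; the arguments come
-- in increasing order.
tripleSign : ℕ → ℕ → Maybe Sign
tripleSign 0 1 = just neg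
tripleSign 0 2 = just neg
tripleSign 1 2 = just neg
tripleSign 0 3 = just pos
tripleSign 1 3 = just neg
tripleSign 0 4 = just pos
tripleSign 2 4 = just neg
tripleSign 1 5 = just pos
tripleSign 2 5 = just neg
tripleSign _ _ = nothing

triple : SignedGraph
triple = record
  { n = 6
  ; σ = τ
  ; sym = toWitness {a? = Fin.all? λ u → Fin.all? λ v → τ u v ≟ᵐ τ v u} tt
  ; loopless = toWitness {a? = Fin.all? λ u → τ u u ≟ᵐ nothing} tt
  }
  where
  τ : Fin 6 → Fin 6 → Maybe Sign
  τ u v = tripleSign (toℕ u ⊓ toℕ v) (toℕ u ⊔ toℕ v)

abstract
  -- With equal exponents, a negative edge joins the two colours of one block, and the negative
  -- two-path through `z` forbids exactly this block.
  doubled-negative-edge⇒signs-differ : ∀ x y z →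
    DSG x y ≡ just neg → DSG x z ≡ just pos → DSG y z ≡ just neg → proj₂ x ≢ proj₂ y
  doubled-negative-edge⇒signs-differ = toWitness {a? =
    allColour? λ x → allColour? λ y → allColour? λ z →
    (DSG x y ≟ᵐ just neg) →-dec ((DSG x z ≟ᵐ just pos) →-dec ((DSG y z ≟ᵐ just neg) →-dec
    ¬? (proj₂ x ≟ˢ proj₂ y)))} tt

three-signs-collide : ∀ (α β γ : Sign) → α ≢ β → α ≢ γ → β ≢ γ → ∀ {A : Set} → A
three-signs-collide pos pos _ p _ _ = contradiction refl p
three-signs-collide neg neg _ p _ _ = contradiction refl p
three-signs-collide pos neg pos _ p _ = contradiction refl p
three-signs-collide neg pos neg _ p _ = contradiction refl p
three-signs-collide pos neg neg _ _ p = contradiction refl p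
three-signs-collide neg pos pos _ _ p = contradiction refl p

triple-no-hom : ¬ Hom triple DSG
triple-no-hom (φ , hom) = three-signs-collide (proj₂ (φ 0F)) (proj₂ (φ 1F)) (proj₂ (φ 2F))
  (doubled-negative-edge⇒signs-differ (φ 0F) (φ 1F) (φ 3F)
    (hom 0F 1F neg refl) (hom 0F 3F pos refl) (hom 1F 3F neg refl))
  (doubled-negative-edge⇒signs-differ (φ 0F) (φ 2F) (φ 4F)
    (hom 0F 2F neg refl) (hom 0F 4F pos refl) (hom 2F 4F neg refl))
  (doubled-negative-edge⇒signs-differ (φ 1F) (φ 2F) (φ 5F)
    (hom 1F 2F neg refl) (hom 1F 5F pos refl) (hom 2F 5F neg refl))

module _ where
  open Discharging triple

  edges vertices : (Fin 6 → Bool) → ℕ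
  edges S = ∑ (allFin 6) (λ u → ∑ (allFin 6) (λ v → below u v * ⟦ induced S u v ⟧))
  vertices S = ∑ (allFin 6) (⟦_⟧ ∘ S)

  -- A vertex set is given by its six truth values, so that the 64 cases can be enumerated.
  triple-sparse : ∀ a b c d e f → let S = Vec.lookup (a ∷ b ∷ c ∷ d ∷ e ∷ f ∷ []) in
    2 * edges S ≤ 3 * vertices S
  triple-sparse = toWitness {a? = allBool? λ a → allBool? λ b → allBool? λ c → allBool? λ d →
    allBool? λ e → allBool? λ f → let S = Vec.lookup (a ∷ b ∷ c ∷ d ∷ e ∷ f ∷ []) in
    2 * edges S ≤? 3 * vertices S} tt

  -- Every chosen edge has both ends in `S`, so it is enough to check induced subgraphs.
  ecount≤edges : ∀ S F → IsSubgraph triple S F → ecount F ≤ edges S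
  ecount≤edges S F sub = begin
    ecount F                                                                     ≡⟨ ecount-∑ F ⟩
    ∑ (allFin 6) (λ u → ∑ (allFin 6) (λ v → below u v * ⟦ F u v ⟧))              ≤⟨ ∑-mono-≤ (allFin 6)
      (λ u → ∑-mono-≤ (allFin 6) (λ v → bound u v)) ⟩
    edges S                                                                      ∎
    where
    open ≤-Reasoning
    bound : ∀ u v → below u v * ⟦ F u v ⟧ ≤ below u v * ⟦ induced S u v ⟧
    bound u v = below-*-mono-≤ u v F≤
      where
      F≤ : toℕ u < toℕ v → ⟦ F u v ⟧ ≤ ⟦ induced S u v ⟧
      F≤ u<v with F u v in Fuv
      ... | false = z≤n
      ... | true with sub u v u<v Fuv
      ...   | adj , Su , Sv rewrite Su | Sv | Equivalence.to T-≡ adj = ≤-refl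

  triple-mad : MadEq3 triple
  -- The whole graph attains equality: nine edges on six vertices.
  triple-mad = upper , (λ _ → true) , induced (λ _ → true) , induced-subgraph (λ _ → true) ,
    toWitness {a? = 1 ≤? 6} tt , refl
    where
    upper : ∀ S F → IsSubgraph triple S F → 1 ≤ vcount S → 2 * ecount F ≤ 3 * vcount S
    upper S F sub _ = begin
      2 * ecount F      ≤⟨ *-monoʳ-≤ 2 (ecount≤edges S F sub) ⟩
      -- The sums evaluate `S` only at the six literals, so the table of its values gives the same
      -- sums by computation.
      2 * edges S       ≤⟨ triple-sparse (S 0F) (S 1F) (S 2F) (S 3F) (S 4F) (S 5F) ⟩
      3 * vertices S    ≡⟨ cong (3 *_) (vcount-∑ S) ⟨
      3 * vcount S      ∎
      where open ≤-Reasoning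

theorem6p1 : ((G : SignedGraph) → MadLt3 G → Hom G DSG)
    × (∃[ G ] (MadEq3 G × ¬ Hom G DSG))
theorem6p1 = Sparse.hom , triple , triple-mad , triple-no-hom
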